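{- Let $L$ be a reduced Latin square of order $n$ with row permutations $\sigma_1,\dots,\sigma_n$, and let $\sigma_l$ be a row of $L$ whose cycle representation has the minimal number of cycles among all rows, i.e. $\nu(\sigma_l)=\nu(L)$. Suppose $\sigma_l=(C_1)(C_2)\cdots(C_{\nu(L)})$ is the decomposition of $\sigma_l$ into disjoint cycles (cycles of length 1 included), and assume that $l\in C_1$. Then $$|\mathfrak{A}(L)|\le n\,\delta(L)\,\lambda(L,l)\prod_{i=2}^{\nu(L)}\lambda(L,C_i).$$
   Context: A Latin square of order $n$ is an $n\times n$ array with entries in $[n]=\{1,\dots,n\}$ such that each row and each column is a permutation of $[n]$. It is reduced if its first row and first column are both the identity permutation. Row $i$ of $L$ is viewed as the permutation $\sigma_i\in S_n$ with $\sigma_i(j)=L(i,j)$. Permutations are composed as functions, right to left. An isotopism is a triple $(\alpha,\beta,\gamma)\in S_n^3$, acting on Latin squares of order $n$ by permuting rows by $\alpha$, columns by $\beta$ and symbols by $\gamma$: $L'=(\alpha,\beta,\gamma)(L)$ is given by $L'(\alpha(i),\beta(j))=\gamma(L(i,j))$. The autotopy group $\mathfrak{A}(L)$ is the group of isotopisms $\Theta$ with $\Theta(L)=L$. For $\sigma\in S_n$, $\nu(\sigma)$ is the number of cycles in its disjoint cycle decomposition, including cycles of length 1; the cycle structure of $\sigma$ is the partition of $n$ given by its cycle lengths. Put $\nu(L)=\min_i\nu(\sigma_i)$. For $s\in[n]$, $\lambda(L,s)$ is the number of rows of $L$ with the same cycle structure as $\sigma_s$ (including $\sigma_s$ itself).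 For a cycle $C$ of a row permutation of $L$ (identified with its set of elements), $\lambda(L,C)=\min_{s\in C}\lambda(L,s)$. $\Delta(L)$ is the set of $m\in[n]$ such that the multiset of cycle structures of the permutations $\sigma_i\sigma_m^{ -1}$, $i=1,\dots,n$, equals the multiset of cycle structures of $\sigma_1,\dots,\sigma_n$. Put $\delta(L)=|\Delta(L)|$. -}

module Defs where

open import Data.Bool.Properties using () renaming (_≟_ to _≟ᵇ_)
open import Data.Fin.Base using (Fin; zero; suc; toℕ; punchIn)
open import Data.Fin.Permutation
  using (Permutation′; _⟨$⟩ʳ_; _≈_; _∘ₚ_; flip; insert; remove; insert-remove)
  renaming (id to idₚ)
open import Data.Fin.Properties using (all?; punchIn-injective) renaming (_≟_ to _≟ᶠ_)
open import Data.Fin.Subset using (Subset; ⁅_⁆; ⋃; ∣_∣)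
open import Data.Fin.Subset.Properties using (_∈?_)
open import Data.List.Base
  using (List; []; _∷_; _++_; map; filter; length; tabulate; allFin; iterate; deduplicate;
         cartesianProduct; cartesianProductWith)
open import Data.List.Extrema.Nat using (min)
open import Data.List.Membership.Propositional.Properties using (∈-∃++; ∈-allFin)
open import Data.List.Membership.Setoid.Properties using (∈-cartesianProductWith⁺; ∈-resp-≈)
open import Data.List.Properties using () renaming (≡-dec to ≡-decˡ)
open import Data.List.Relation.Binary.Permutation.Propositional
  using (_↭_; ↭-refl; ↭-sym; ↭-trans; prep)
open import Data.List.Relation.Binary.Permutation.Propositional.Properties
  using (∈-resp-↭; drop-∷; shift; ¬x∷xs↭[])
open import Data.List.Relation.Unary.Any using (here; any?)
open import Data.List.Relation.Unary.Enumerates.Setoid using (IsEnumeration)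
import Data.List.Relation.Unary.Enumerates.Setoid.Properties as Enumerates
open import Data.List.Relation.Unary.Unique.Setoid using (Unique)
import Data.List.Relation.Unary.Unique.Setoid.Properties as Unique
import Data.List.Relation.Unary.Unique.Propositional.Properties as Uniqueₚ
import Data.List.Relation.Unary.All as All
import Data.List.Relation.Unary.AllPairs as AllPairs
open import Data.List.Sort using (sort)
open import Data.Nat.Base using (ℕ; zero; suc)
open import Data.Nat.Properties using (≤-decTotalOrder) renaming (_≟_ to _≟ⁿ_)
open import Data.Product.Base using (_×_; _,_)
open import Data.Product.Relation.Binary.Pointwise.NonDependent using (_×ₛ_)
open import Data.Vec.Properties using () renaming (≡-dec to ≡-decᵛ)
open import Function.Bundles using (mk⤖)
open import Function.Base using (_∘_)
open import Function.Definitions using (Bijective)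
open import Function.Properties.Bijection using (⤖⇒↔)
open import Level using (0ℓ)
open import Relation.Binary.Bundles using (Setoid)
open import Relation.Binary.Definitions using (DecidableEquality)
open import Relation.Binary.PropositionalEquality.Core using (_≡_; refl; sym; trans; cong)
open import Relation.Binary.PropositionalEquality.Properties using () renaming (setoid to ≡-setoid)
open import Relation.Nullary using (Dec; yes; no)

private
  variable
    n : ℕ

-- [n] is represented by Fin n, so the element 1 of [n] becomes the index 0.

record LatinSquare (n : ℕ) : Set where
  field
    entry    : Fin n → Fin n → Fin n
    row-perm : ∀ i → Bijective _≡_ _≡_ (λ j → entry i j)
    col-perm : ∀ j → Bijective _≡_ _≡_ (λ i → entry i j)

open LatinSquare public using (entry)

Reduced : LatinSquare n → Set
Reduced L = ∀ o → toℕ o ≡ 0 → (∀ j → entry L o j ≡ j) × (∀ i → entry L i o ≡ i)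

σ : LatinSquare n → Fin n → Permutation′ n
σ L i = ⤖⇒↔ (mk⤖ (LatinSquare.row-perm L i))

-- The cycle through s, as the set of its elements; it has at most n
-- elements, so the iterates π⁰ s, …, πⁿ⁻¹ s exhaust it.
orbit : Permutation′ n → Fin n → Subset n
orbit {n} π s = ⋃ (map ⁅_⁆ (iterate (π ⟨$⟩ʳ_) s n))

cycles : Permutation′ n → List (Subset n)
cycles {n} π = deduplicate (≡-decᵛ _≟ᵇ_) (map (orbit π) (allFin n))

ν : Permutation′ n → ℕ
ν π = length (cycles π)

-- Partitions of n are sorted lists, so that equal partitions are equal lists.
cycleStructure : Permutation′ n → List ℕ
cycleStructure π = sort ≤-decTotalOrder (map ∣_∣ (cycles π))

_≟ᶜ_ : DecidableEquality (List ℕ)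
_≟ᶜ_ = ≡-decˡ _≟ⁿ_

-- In νᴸ and λᶜ the default value n of min is harmless: all values
-- minimised over are at most n, and the sets in question are nonempty
-- (rows of a square of order n > 0, elements of a cycle).
νᴸ : LatinSquare n → ℕ
νᴸ {n} L = min n (map (λ i → ν (σ L i)) (allFin n))

λʳ : LatinSquare n → Fin n → ℕ
λʳ {n} L s =
  length (filter (λ i → cycleStructure (σ L i) ≟ᶜ cycleStructure (σ L s)) (allFin n))

λᶜ : LatinSquare n → Subset n → ℕ
λᶜ {n} L C = min n (map (λʳ L) (filter (_∈? C) (allFin n)))


module _ {A : Set} (_≟_ : DecidableEquality A) where

  ↭-dec : (xs ys : List A) → Dec (xs ↭ ys)
  ↭-dec []       []       = yes ↭-refl
  ↭-dec []       (y ∷ ys) = no (¬x∷xs↭[] ∘ ↭-sym)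
  ↭-dec (x ∷ xs) ys with any? (x ≟_) ys
  ... | no  x∉ys = no λ p → x∉ys (∈-resp-↭ p (here refl))
  ... | yes x∈ys with ∈-∃++ x∈ys
  ...   | as , bs , refl with ↭-dec xs (as ++ bs)
  ...     | yes p = yes (↭-trans (prep x p) (↭-sym (shift x as bs)))
  ...     | no ¬p = no λ q → ¬p (drop-∷ (↭-trans q (shift x as bs)))

-- _∘ₚ_ applies its left argument first, so this is σᵢ σₘ⁻¹.
σᵢσₘ⁻¹ : LatinSquare n → Fin n → Fin n → Permutation′ n
σᵢσₘ⁻¹ L m i = flip (σ L m) ∘ₚ σ L i

-- Multisets are lists up to _↭_.
Δ : LatinSquare n → Fin n → Set
Δ L m = tabulate (λ i → cycleStructure (σᵢσₘ⁻¹ L m i))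
      ↭ tabulate (λ i → cycleStructure (σ L i))

Δ? : (L : LatinSquare n) (m : Fin n) → Dec (Δ L m)
Δ? L m = ↭-dec _≟ᶜ_ _ _

δ : LatinSquare n → ℕ
δ {n} L = length (filter (Δ? L) (allFin n))

Isotopism : ℕ → Set
Isotopism n = Permutation′ n × Permutation′ n × Permutation′ n

-- Θ ⟪ L ⟫≡ L′ says Θ(L) = L′.
_⟪_⟫≡_ : Isotopism n → LatinSquare n → LatinSquare n → Set
(α , β , γ) ⟪ L ⟫≡ L′ =
  ∀ i j → entry L′ (α ⟨$⟩ʳ i) (β ⟨$⟩ʳ j) ≡ γ ⟨$⟩ʳ entry L i j

IsAutotopism : LatinSquare n → Isotopism n → Set
IsAutotopism L Θ = Θ ⟪ L ⟫≡ L

isAutotopism? : (L : LatinSquare n) (Θ : Isotopism n) → Dec (IsAutotopism L Θ)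
isAutotopism? L Θ = all? λ i → all? λ j → _ ≟ᶠ _

-- Elements of Sₙ and of Sₙ³ are identified when they agree as functions,
-- and permutations n and isotopisms n list them without omission or
-- repetition with respect to that equality (see the lemmas at the end).

Sym : ℕ → Setoid 0ℓ 0ℓ
Sym n = record
  { Carrier       = Permutation′ n
  ; _≈_           = _≈_
  ; isEquivalence = record
    { refl  = λ _ → refl
    ; sym   = λ p i → sym (p i)
    ; trans = λ p q i → trans (p i) (q i)
    }
  }

Sym³ : ℕ → Setoid 0ℓ 0ℓ
Sym³ n = Sym n ×ₛ (Sym n ×ₛ Sym n)

permutations : ∀ n → List (Permutation′ n)
permutations zero    = idₚ ∷ []
permutations (suc n) = cartesianProductWith (insert zero) (allFin (suc n)) (permutations n)

isotopisms : ∀ n → List (Isotopism n)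
isotopisms n =
  cartesianProduct (permutations n) (cartesianProduct (permutations n) (permutations n))

𝔄 : LatinSquare n → List (Isotopism n)
𝔄 {n} L = filter (isAutotopism? L) (isotopisms n)

∣𝔄_∣ : LatinSquare n → ℕ
∣𝔄 L ∣ = length (𝔄 L)

private
  insert-cong : ∀ {j k} {π ρ : Permutation′ n} → j ≡ k → π ≈ ρ →
                insert zero j π ≈ insert zero k ρ
  insert-cong refl π≈ρ zero    = refl
  insert-cong refl π≈ρ (suc i) = cong (punchIn _) (π≈ρ i)

  insert-injective : ∀ {j k} {π ρ : Permutation′ n} →
                     insert zero j π ≈ insert zero k ρ → j ≡ k × π ≈ ρ
  insert-injective {j = j} {k} {π} {ρ} eq with refl ← eq zero =
    refl , λ i → punchIn-injective j _ _ (eq (suc i))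

permutations-complete : ∀ n → IsEnumeration (Sym n) (permutations n)
permutations-complete zero    π = here λ ()
permutations-complete (suc n) π =
  ∈-resp-≈ (Sym (suc n)) {x = insert zero (π ⟨$⟩ʳ zero) (remove zero π)} {y = π}
    (insert-remove zero π)
    (∈-cartesianProductWith⁺ (≡-setoid _) (Sym n) (Sym (suc n))
      (λ {_} {_} {π} {ρ} → insert-cong {π = π} {ρ})
      (∈-allFin (π ⟨$⟩ʳ zero)) (permutations-complete n (remove zero π)))

permutations-unique : ∀ n → Unique (Sym n) (permutations n)
permutations-unique zero    = All.[] AllPairs.∷ AllPairs.[]
permutations-unique (suc n) =
  Unique.cartesianProductWith⁺ (≡-setoid _) (Sym n) (Sym (suc n)) (insert zero)
    (λ {_} {_} {π} {ρ} → insert-injective {π = π} {ρ}) (Uniqueₚ.allFin⁺ (suc n)) (permutations-unique n)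

isotopisms-complete : ∀ n → IsEnumeration (Sym³ n) (isotopisms n)
isotopisms-complete n =
  Enumerates.cartesianProduct⁺ (Sym n) (Sym n ×ₛ Sym n) (permutations-complete n)
    (Enumerates.cartesianProduct⁺ (Sym n) (Sym n) (permutations-complete n) (permutations-complete n))

isotopisms-unique : ∀ n → Unique (Sym³ n) (isotopisms n)
isotopisms-unique n =
  Unique.cartesianProduct⁺ (Sym n) (Sym n ×ₛ Sym n) (permutations-unique n)
    (Unique.cartesianProduct⁺ (Sym n) (Sym n) (permutations-unique n) (permutations-unique n))

{-# OPTIONS --safe #-}
-- Write o for the first index. For an autotopism (α, β, γ) and m = α(o), the
-- relation σ_{α(i)} β = γ σ_i with σ_o = id gives γ σ_i γ⁻¹ = σ_{α(i)} σ_m⁻¹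
-- for all i. Hence m ∈ Δ(L), and for each s, given m, there are only λ(L, s)
-- candidates for α(s). Since σ_s(o) = s, also γ(s) = σ_{α(s)}(β(o)); and
-- because γ conjugates σ_l to σ_{α(l)} σ_m⁻¹, its values on a whole cycle of
-- σ_l follow from m, α(l) and one value on that cycle. So the autotopism is
-- determined by β(o), α(o), α(l) and α(s) for one s in each of the other
-- cycles, and s can be chosen to minimise λ(L, s).
module Submission where

open import Defs
open import Data.Bool.Base using (true; false; if_then_else_)
open import Data.Bool.Properties using () renaming (_≟_ to _≟ᵇ_)
open import Data.Nat.Base using (ℕ; zero; suc; _+_; _*_; _≤_; z≤n; s≤s)
open import Data.Nat.Properties
  using (+-suc; +-mono-≤; *-mono-≤; *-monoʳ-≤; +-0-commutativeMonoid;
         ≤-refl; ≤-reflexive; ≤-trans; ≤-decTotalOrder; ≤-totalOrder; module ≤-Reasoning)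
open import Data.Fin.Base using (Fin; zero)
open import Data.Fin.Permutation
  using (Permutation′; _⟨$⟩ʳ_; _⟨$⟩ˡ_; inverseˡ; inverseʳ; flip)
import Data.Fin.Properties as Fin
open import Data.Fin.Subset using (Subset; _∈_; ⁅_⁆; ⋃; ∣_∣)
open import Data.Fin.Subset.Properties
  using (_∈?_; ⊆-antisym; x∈⁅x⁆; x∈⁅y⁆⇒x≡y; ∉⊥; x∈p∪q⁺; x∈p∪q⁻)
open import Data.List.Base
  using (List; []; _∷_; map; filter; length; tabulate; allFin; iterate)
open import Data.List.Extrema.Nat using (argmin-sel)
open import Data.List.Properties
  using (map-cong; map-∘; map-tabulate; tabulate-cong; length-filter; length-tabulate)
open import Data.List.Sort ≤-decTotalOrder using (sort-↭; sort-↗)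
open import Data.List.Membership.Propositional using () renaming (_∈_ to _∈ˡ_)
open import Data.List.Membership.Propositional.Properties
  using (∈-allFin; ∈-filter⁺; ∈-filter⁻; ∈-map⁺; ∈-map⁻; ∈-tabulate⁺; ∈-deduplicate⁺; ∈-deduplicate⁻)
open import Data.List.Membership.Propositional.Properties.WithK using (unique∧set⇒bag)
open import Data.List.Relation.Binary.BagAndSetEquality using (∼bag⇒↭)
open import Data.List.Relation.Binary.Permutation.Propositional
  using (_↭_; ↭-sym; ↭-trans; ↭-reflexive; ↭⇒↭ₛ)
open import Data.List.Relation.Binary.Permutation.Propositional.Properties
  using (∈-resp-↭; map⁺; ↭-length; filter-↭)
open import Data.List.Relation.Binary.Pointwise using (Pointwise-≡⇒≡)
open import Data.List.Relation.Unary.All as All using (All; []; _∷_)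
open import Data.List.Relation.Unary.All.Properties using (all-filter)
import Data.List.Relation.Unary.All.Properties as Allₚ
open import Data.List.Relation.Unary.AllPairs using (AllPairs; []; _∷_)
import Data.List.Relation.Unary.AllPairs.Properties as AllPairsₚ
open import Data.List.Relation.Unary.Any using (here; there)
open import Data.List.Relation.Unary.Sorted.TotalOrder.Properties using (↗↭↗⇒≋)
open import Data.List.Relation.Unary.Unique.DecPropositional.Properties using (deduplicate-!)
import Data.List.Relation.Unary.Unique.Propositional.Properties as Uniqueₚ
open import Data.Nat.ListAction using (product)
open import Data.Nat.Tactic.RingSolver using (solve-∀)
open import Data.Product.Base using (_×_; _,_; ∃; proj₁; proj₂)
open import Data.Sum.Base using (inj₁; inj₂)
open import Data.Vec.Base using ([]; _∷_; lookup) renaming (tabulate to tabulateᵛ)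
open import Data.Vec.Properties
  using (lookup∘tabulate; tabulate∘lookup; []=⇒lookup; lookup⇒[]=)
  renaming (≡-dec to ≡-decᵛ; tabulate-cong to tabulateᵛ-cong)
open import Function.Base using (_∘_; id)
open import Function.Bundles using (mk⇔)
open import Algebra.Properties.CommutativeMonoid.Sum +-0-commutativeMonoid
  using (sum; sum-permute; sum-cong-≗)
open import Level using (0ℓ)
open import Relation.Binary.Bundles using (Setoid)
open import Relation.Binary.Core using (Rel)
open import Relation.Binary.Definitions using (DecidableEquality)
open import Relation.Binary.PropositionalEquality
  using (_≡_; _≢_; refl; sym; trans; cong; cong₂; subst; module ≡-Reasoning)
open import Relation.Nullary using (¬_; yes; no; contradiction)
open import Relation.Nullary.Decidable using (¬?)
open import Relation.Unary using (Pred; Decidable)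

private
  variable
    n : ℕ
    A B : Set

-- Counting elements of filtered lists.

length-filter-split : {P : Pred A 0ℓ} (P? : Decidable P) (xs : List A) →
                      length xs ≡ length (filter P? xs) + length (filter (¬? ∘ P?) xs)
length-filter-split P? []       = refl
length-filter-split P? (x ∷ xs) with P? x
... | yes _ = cong suc (length-filter-split P? xs)
... | no  _ = trans (cong suc (length-filter-split P? xs)) (sym (+-suc _ _))

length-filter-map : (f : A → B) {P : Pred B 0ℓ} (P? : Decidable P) (xs : List A) →
                    length (filter P? (map f xs)) ≡ length (filter (P? ∘ f) xs)
length-filter-map f P? []       = refl
length-filter-map f P? (x ∷ xs) with P? (f x)
... | yes _ = cong suc (length-filter-map f P? xs)
... | no  _ = length-filter-map f P? xs

-- Cardinality bounds up to an equality _≈_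

module _ (_≈_ : Rel A 0ℓ) where

  -- Testing against lists of pairwise inequivalent elements allows isotopisms to be counted up to
  -- pointwise equality, without forming a quotient.
  AtMost : ℕ → Pred A 0ℓ → Set
  AtMost k P = ∀ xs → AllPairs (λ x y → ¬ x ≈ y) xs → All P xs → length xs ≤ k

  AtMost-one : {P : Pred A 0ℓ} → (∀ x y → P x → P y → x ≈ y) → AtMost 1 P
  AtMost-one eq []          _                  _              = z≤n
  AtMost-one eq (x ∷ [])    _                  _              = s≤s z≤n
  AtMost-one eq (x ∷ y ∷ _) ((x≉y ∷ _) ∷ _) (px ∷ py ∷ _) =
    contradiction (eq x y px py) x≉y

  AtMost-⊆ : ∀ {k} {P Q : Pred A 0ℓ} → (∀ {x} → P x → Q x) → AtMost k Q → AtMost k P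
  AtMost-⊆ P⊆Q bound xs xs! pxs = bound xs xs! (All.map P⊆Q pxs)

  module _ (_≟_ : DecidableEquality B) where

    -- Induction on `ys`: the elements sent to the head form one fibre, and all others take values
    -- in the tail.
    AtMost-fibres : (f : A → B) (ys : List B) {k : ℕ} {P : Pred A 0ℓ} →
                    (∀ {x} → P x → f x ∈ˡ ys) →
                    (∀ y → y ∈ˡ ys → AtMost k (λ x → P x × f x ≡ y)) →
                    AtMost (length ys * k) P
    AtMost-fibres f []       f∈ys fibre []      _   _        = z≤n
    AtMost-fibres f []       f∈ys fibre (x ∷ _) _   (px ∷ _) with () ← f∈ys px
    AtMost-fibres f (y ∷ ys) {k} {P} f∈ys fibre xs xs! pxs = begin
      length xs
        ≡⟨ length-filter-split f≟y xs ⟩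
      length (filter f≟y xs) + length (filter (¬? ∘ f≟y) xs)
        ≤⟨ +-mono-≤
             (fibre y (here refl) _ (AllPairsₚ.filter⁺ f≟y xs!)
               (All.zip (Allₚ.filter⁺ f≟y pxs , all-filter f≟y xs)))
             (AtMost-fibres f ys f∈ys′ fibre′ _ (AllPairsₚ.filter⁺ (¬? ∘ f≟y) xs!)
               (All.zip (Allₚ.filter⁺ (¬? ∘ f≟y) pxs , all-filter (¬? ∘ f≟y) xs))) ⟩
      k + length ys * k ∎
      where
      open ≤-Reasoning
      f≟y : Decidable (λ x → f x ≡ y)
      f≟y x = f x ≟ y
      f∈ys′ : ∀ {x} → P x × f x ≢ y → f x ∈ˡ ys
      f∈ys′ (px , fx≢y) with f∈ys px
      ... | here fx≡y = contradiction fx≡y fx≢y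
      ... | there p   = p
      fibre′ : ∀ z → z ∈ˡ ys → AtMost k (λ x → (P x × f x ≢ y) × f x ≡ z)
      fibre′ z z∈ys = AtMost-⊆ (λ ((px , _) , fx≡z) → px , fx≡z) (fibre z (there z∈ys))

    -- Each index in `is` fixes one more coordinate `f i x`, which has `length (ys i)` possible
    -- values; once all coordinates are fixed, at most one element remains.
    AtMost-product : {I : Set} (f : I → A → B) (ys : I → List B)
                     (is : List I) {P : Pred A 0ℓ} →
                     (∀ i {x} → P x → f i x ∈ˡ ys i) →
                     (∀ x y → P x → P y → (∀ i → i ∈ˡ is → f i x ≡ f i y) → x ≈ y) →
                     AtMost (product (map (length ∘ ys) is)) P
    AtMost-product f ys []       f∈ys determined =
      AtMost-one λ x y px py → determined x y px py λ _ ()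
    AtMost-product f ys (i ∷ is) f∈ys determined =
      AtMost-fibres (f i) (ys i) (f∈ys i) λ z _ →
        AtMost-product f ys is (λ j (px , _) → f∈ys j px)
          λ x y (px , fx≡z) (py , fy≡z) agree → determined x y px py
            λ { _ (here refl) → trans fx≡z (sym fy≡z)
              ; j (there j∈is) → agree j j∈is }

-- Subsets and their images under permutations

∈-⋃⁅⁆⁺ : ∀ {x : Fin n} xs → x ∈ˡ xs → x ∈ ⋃ (map ⁅_⁆ xs)
∈-⋃⁅⁆⁺ (_ ∷ _)  (here refl)  = x∈p∪q⁺ (inj₁ (x∈⁅x⁆ _))
∈-⋃⁅⁆⁺ (_ ∷ xs) (there x∈xs) = x∈p∪q⁺ (inj₂ (∈-⋃⁅⁆⁺ xs x∈xs))

∈-⋃⁅⁆⁻ : ∀ {x : Fin n} xs → x ∈ ⋃ (map ⁅_⁆ xs) → x ∈ˡ xs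
∈-⋃⁅⁆⁻ []       x∈⊥ = contradiction x∈⊥ ∉⊥
∈-⋃⁅⁆⁻ (y ∷ ys) x∈∪ with x∈p∪q⁻ ⁅ y ⁆ _ x∈∪
... | inj₁ x∈⁅y⁆ = here (x∈⁅y⁆⇒x≡y y x∈⁅y⁆)
... | inj₂ x∈⋃   = there (∈-⋃⁅⁆⁻ ys x∈⋃)

image : Permutation′ n → Subset n → Subset n
image γ S = tabulateᵛ (λ i → lookup S (γ ⟨$⟩ˡ i))

module _ (γ : Permutation′ n) where

  ∈-image⁺ : ∀ {S x} → γ ⟨$⟩ˡ x ∈ S → x ∈ image γ S
  ∈-image⁺ {x = x} p = lookup⇒[]= x _ (trans (lookup∘tabulate _ x) ([]=⇒lookup p))

  ∈-image⁻ : ∀ {S x} → x ∈ image γ S → γ ⟨$⟩ˡ x ∈ S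
  ∈-image⁻ {S} {x} p = lookup⇒[]= _ S (trans (sym (lookup∘tabulate _ x)) ([]=⇒lookup p))

  image-injective : ∀ {S T} → image γ S ≡ image γ T → S ≡ T
  image-injective {S} {T} eq = begin
    S                    ≡⟨ tabulate∘lookup S ⟨
    tabulateᵛ (lookup S) ≡⟨ tabulateᵛ-cong lookup-≗ ⟩
    tabulateᵛ (lookup T) ≡⟨ tabulate∘lookup T ⟩
    T                    ∎
    where
    open ≡-Reasoning
    lookup-image : ∀ U i → lookup (image γ U) (γ ⟨$⟩ʳ i) ≡ lookup U i
    lookup-image U i = trans (lookup∘tabulate _ (γ ⟨$⟩ʳ i)) (cong (lookup U) (inverseˡ γ))
    lookup-≗ : ∀ i → lookup S i ≡ lookup T i
    lookup-≗ i = trans (sym (lookup-image S i))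
                   (trans (cong (λ U → lookup U (γ ⟨$⟩ʳ i)) eq) (lookup-image T i))

-- As a sum of indicator values, cardinality becomes invariant under permutations by reindexing.
∣∣-sum : (S : Subset n) → ∣ S ∣ ≡ sum (λ i → if lookup S i then 1 else 0)
∣∣-sum []                       = refl
∣∣-sum (true ∷ S)  = cong suc (∣∣-sum S)
∣∣-sum (false ∷ S) = ∣∣-sum S

∣image∣ : (γ : Permutation′ n) (S : Subset n) → ∣ image γ S ∣ ≡ ∣ S ∣
∣image∣ γ S = begin
  ∣ image γ S ∣
    ≡⟨ ∣∣-sum (image γ S) ⟩
  sum (λ i → if lookup (image γ S) i then 1 else 0)
    ≡⟨ sum-cong-≗ (λ i → cong (if_then 1 else 0) (lookup∘tabulate (λ i → lookup S (γ ⟨$⟩ˡ i)) i)) ⟩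
  sum (λ i → if lookup S (γ ⟨$⟩ˡ i) then 1 else 0)
    -- The reindexing is along `flip γ` because `image γ S` reads `S` through the inverse of `γ`.
    ≡⟨ sum-permute (λ i → if lookup S i then 1 else 0) (flip γ) ⟨
  sum (λ i → if lookup S i then 1 else 0)
    ≡⟨ ∣∣-sum S ⟨
  ∣ S ∣ ∎
  where open ≡-Reasoning

-- Cycles and cycle structures

⟨$⟩ʳ-injective : (π : Permutation′ n) → ∀ {x y} → π ⟨$⟩ʳ x ≡ π ⟨$⟩ʳ y → x ≡ y
⟨$⟩ʳ-injective π eq = trans (sym (inverseˡ π)) (trans (cong (π ⟨$⟩ˡ_) eq) (inverseˡ π))

s∈orbit : (π : Permutation′ n) (s : Fin n) → s ∈ orbit π s
-- An element of `Fin` forces positive order, so the list of iterates is nonempty and starts with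
-- `s`.
s∈orbit {suc n} π s = ∈-⋃⁅⁆⁺ (iterate (π ⟨$⟩ʳ_) s (suc n)) (here refl)

orbit∈cycles : (π : Permutation′ n) (s : Fin n) → orbit π s ∈ˡ cycles π
orbit∈cycles π s =
  ∈-deduplicate⁺ (≡-decᵛ _≟ᵇ_) (∈-map⁺ (orbit π) (∈-allFin s))

∈-cycles⁻ : (π : Permutation′ n) {C : Subset n} → C ∈ˡ cycles π → ∃ λ s → C ≡ orbit π s
∈-cycles⁻ π C∈ with s , _ , eq ← ∈-map⁻ (orbit π) (∈-deduplicate⁻ (≡-decᵛ _≟ᵇ_) _ C∈) = s , eq

iterate-commute : {f : A → A} {g : B → B} {h : A → B} → (∀ x → g (h x) ≡ h (f x)) →
                  ∀ x k → iterate g (h x) k ≡ map h (iterate f x k)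
iterate-commute comm x zero    = refl
iterate-commute {g = g} {h} comm x (suc k) = cong (h x ∷_)
  (trans (cong (λ y → iterate g y k) (comm x)) (iterate-commute comm _ k))

module _ (π ρ γ : Permutation′ n) (conj : ∀ x → ρ ⟨$⟩ʳ (γ ⟨$⟩ʳ x) ≡ γ ⟨$⟩ʳ (π ⟨$⟩ʳ x)) where

  orbit-conj : ∀ s → orbit ρ (γ ⟨$⟩ʳ s) ≡ image γ (orbit π s)
  -- By conjugacy the `ρ`-iterates of `γ(s)` are the `γ`-images of the `π`-iterates of `s`.
  orbit-conj s rewrite iterate-commute {f = π ⟨$⟩ʳ_} {ρ ⟨$⟩ʳ_} {γ ⟨$⟩ʳ_} conj s n = ⊆-antisym to from
    where
    xs : List (Fin n)
    xs = iterate (π ⟨$⟩ʳ_) s n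
    to : ∀ {x} → x ∈ ⋃ (map ⁅_⁆ (map (γ ⟨$⟩ʳ_) xs)) → x ∈ image γ (⋃ (map ⁅_⁆ xs))
    to x∈ with y , y∈xs , refl ← ∈-map⁻ (γ ⟨$⟩ʳ_) (∈-⋃⁅⁆⁻ (map (γ ⟨$⟩ʳ_) xs) x∈) =
      ∈-image⁺ γ (subst (_∈ _) (sym (inverseˡ γ)) (∈-⋃⁅⁆⁺ xs y∈xs))
    from : ∀ {x} → x ∈ image γ (⋃ (map ⁅_⁆ xs)) → x ∈ ⋃ (map ⁅_⁆ (map (γ ⟨$⟩ʳ_) xs))
    from x∈ = ∈-⋃⁅⁆⁺ (map (γ ⟨$⟩ʳ_) xs)
      (subst (_∈ˡ _) (inverseʳ γ) (∈-map⁺ (γ ⟨$⟩ʳ_) (∈-⋃⁅⁆⁻ xs (∈-image⁻ γ x∈))))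

  -- The two lists may order the cycles differently, but neither has repetitions and both have the
  -- same members, so they agree as multisets.
  cycles-conj : cycles ρ ↭ map (image γ) (cycles π)
  cycles-conj = ∼bag⇒↭ (unique∧set⇒bag
    (deduplicate-! (≡-decᵛ _≟ᵇ_) (map (orbit ρ) (allFin n)))
    (Uniqueₚ.map⁺ (image-injective γ) (deduplicate-! (≡-decᵛ _≟ᵇ_) (map (orbit π) (allFin n))))
    (mk⇔ to from))
    where
    to : ∀ {C} → C ∈ˡ cycles ρ → C ∈ˡ map (image γ) (cycles π)
    to C∈ with s , refl ← ∈-cycles⁻ ρ C∈ =
      subst (_∈ˡ _) (trans (sym (orbit-conj (γ ⟨$⟩ˡ s))) (cong (orbit ρ) (inverseʳ γ)))
        (∈-map⁺ (image γ) (orbit∈cycles π (γ ⟨$⟩ˡ s)))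
    from : ∀ {C} → C ∈ˡ map (image γ) (cycles π) → C ∈ˡ cycles ρ
    from C∈ with D , D∈ , refl ← ∈-map⁻ (image γ) C∈ with s , refl ← ∈-cycles⁻ π D∈ =
      subst (_∈ˡ _) (orbit-conj s) (orbit∈cycles ρ (γ ⟨$⟩ʳ s))

  -- `image γ` preserves sizes, so the cycle lengths agree up to order, and sorted lists that are
  -- permutations of each other coincide.
  cycleStructure-conj : cycleStructure ρ ≡ cycleStructure π
  cycleStructure-conj = Pointwise-≡⇒≡ (↗↭↗⇒≋ ≤-totalOrder (sort-↗ _) (sort-↗ _) (↭⇒↭ₛ
    (↭-trans (sort-↭ _) (↭-trans lengths (↭-sym (sort-↭ _))))))
    where
    lengths : map ∣_∣ (cycles ρ) ↭ map ∣_∣ (cycles π)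
    lengths = ↭-trans (map⁺ ∣_∣ cycles-conj)
      (↭-reflexive (trans (sym (map-∘ (cycles π))) (map-cong (∣image∣ γ) (cycles π))))

-- No symmetry of "lying in a common orbit" is needed: agreement at any point of the orbit
-- propagates back to s by injectivity of τ, and then forward from s.
conj-agree-orbit : (π τ : Permutation′ n) (f g : Fin n → Fin n) →
                   (∀ x → τ ⟨$⟩ʳ f x ≡ f (π ⟨$⟩ʳ x)) → (∀ x → τ ⟨$⟩ʳ g x ≡ g (π ⟨$⟩ʳ x)) →
                   ∀ s {x y} → x ∈ orbit π s → f x ≡ g x → y ∈ orbit π s → f y ≡ g y
conj-agree-orbit {n} π τ f g f-conj g-conj s x∈ fx≡gx y∈ =
  forward s n (back s n (∈-⋃⁅⁆⁻ (iterate (π ⟨$⟩ʳ_) s n) x∈) fx≡gx)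
    (∈-⋃⁅⁆⁻ (iterate (π ⟨$⟩ʳ_) s n) y∈)
  where
  back : ∀ s k {x} → x ∈ˡ iterate (π ⟨$⟩ʳ_) s k → f x ≡ g x → f s ≡ g s
  back s (suc k) (here refl) eq = eq
  back s (suc k) (there x∈)  eq = ⟨$⟩ʳ-injective τ
    (trans (f-conj s) (trans (back (π ⟨$⟩ʳ s) k x∈ eq) (sym (g-conj s))))
  forward : ∀ s k {y} → f s ≡ g s → y ∈ˡ iterate (π ⟨$⟩ʳ_) s k → f y ≡ g y
  forward s (suc k) eq (here refl) = eq
  forward s (suc k) eq (there y∈)  = forward (π ⟨$⟩ʳ s) k
    (trans (sym (f-conj s)) (trans (cong (τ ⟨$⟩ʳ_) eq) (g-conj s))) y∈

-- Reindexing and counting in tabulated lists.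

tabulate-permute : (α : Permutation′ n) (f : Fin n → A) →
                   tabulate (f ∘ (α ⟨$⟩ʳ_)) ↭ tabulate f
tabulate-permute {n} α f =
  ↭-trans (↭-reflexive (sym (map-tabulate (α ⟨$⟩ʳ_) f)))
    (↭-trans (map⁺ f permuted) (↭-reflexive (map-tabulate id f)))
  where
  permuted : tabulate (α ⟨$⟩ʳ_) ↭ allFin n
  permuted = ∼bag⇒↭ (unique∧set⇒bag
    (Uniqueₚ.tabulate⁺ (⟨$⟩ʳ-injective α)) (Uniqueₚ.allFin⁺ n)
    (mk⇔ (λ _ → ∈-allFin _) λ _ → subst (_∈ˡ _) (inverseʳ α) (∈-tabulate⁺ (α ⟨$⟩ˡ _))))

length-filter-tabulate : (f : Fin n → A) {P : Pred A 0ℓ} (P? : Decidable P) →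
                         length (filter P? (tabulate f)) ≡ length (filter (P? ∘ f) (allFin n))
length-filter-tabulate {n} f P? =
  trans (cong (length ∘ filter P?) (sym (map-tabulate id f))) (length-filter-map f P? (allFin n))

-- Autotopisms of a reduced Latin square

module _ (L : LatinSquare n) where

  λᶜ-attained : ∀ C {s} → s ∈ C → ∃ λ t → t ∈ C × λʳ L t ≤ λᶜ L C
  λᶜ-attained C {s} s∈C
    with argmin-sel id n (map (λʳ L) (filter (_∈? C) (allFin n)))
  -- If the minimum is the default `n`, any element of `C` will do, since every `λʳ` counts rows and
  -- is at most `n`.
  ... | inj₁ eq = s , s∈C , subst (λʳ L s ≤_) (sym eq)
                    (≤-trans (length-filter _ (allFin n)) (≤-reflexive (length-tabulate id)))
  ... | inj₂ p with t , t∈ , eq ← ∈-map⁻ (λʳ L) p =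
    t , proj₂ (∈-filter⁻ (_∈? C) {xs = allFin n} t∈) , ≤-reflexive (sym eq)

  -- Taking in each cycle an element that realises the bound `λᶜ` passes from products over cycles
  -- to products over row indices.
  transversal : ∀ Cs → All (λ C → ∃ (_∈ C)) Cs →
                ∃ λ ss → (∀ {C} → C ∈ˡ Cs → ∃ λ s → s ∈ˡ ss × s ∈ C) ×
                         product (map (λʳ L) ss) ≤ product (map (λᶜ L) Cs)
  transversal []       []                 = [] , (λ ()) , ≤-refl
  transversal (C ∷ Cs) ((_ , s∈C) ∷ rest)
    with t , t∈C , t≤ ← λᶜ-attained C s∈C
    with ss , meets , ss≤ ← transversal Cs rest =
    t ∷ ss ,
    (λ { (here refl) → t , here refl , t∈C
       ; (there D∈) → let s , s∈ss , s∈D = meets D∈ in s , there s∈ss , s∈D }) ,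
    *-mono-≤ t≤ ss≤

  -- The possible values of `α(s)` for an autotopism with `α(o) = m`.
  candidates : Fin n → Fin n → List (Fin n)
  candidates m s =
    filter (λ i → cycleStructure (σᵢσₘ⁻¹ L m i) ≟ᶜ cycleStructure (σ L s)) (allFin n)

  -- The number of rows with a given structure depends only on the multiset of structures, and `Δ`
  -- says that the two multisets agree.
  length-candidates : ∀ {m} → Δ L m → ∀ s → length (candidates m s) ≡ λʳ L s
  length-candidates {m} m∈Δ s = begin
    length (candidates m s)
      ≡⟨ length-filter-tabulate (λ i → cycleStructure (σᵢσₘ⁻¹ L m i)) same ⟨
    length (filter same (tabulate (λ i → cycleStructure (σᵢσₘ⁻¹ L m i))))
      ≡⟨ ↭-length (filter-↭ same m∈Δ) ⟩
    length (filter same (tabulate (λ i → cycleStructure (σ L i))))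
      ≡⟨ length-filter-tabulate (λ i → cycleStructure (σ L i)) same ⟩
    λʳ L s ∎
    where
    open ≡-Reasoning
    same : Decidable (_≡ cycleStructure (σ L s))
    same c = c ≟ᶜ cycleStructure (σ L s)

module ReducedSquare (L : LatinSquare (suc n)) (reduced : Reduced L) where

  o : Fin (suc n)
  o = zero

  row-o : ∀ j → entry L o j ≡ j
  row-o = proj₁ (reduced o refl)

  column-o : ∀ i → entry L i o ≡ i
  column-o = proj₂ (reduced o refl)

  αᵒ βᵒ γᵒ : Isotopism (suc n) → Fin (suc n) → Fin (suc n)
  αᵒ (α , _ , _) = α ⟨$⟩ʳ_
  βᵒ (_ , β , _) = β ⟨$⟩ʳ_
  γᵒ (_ , _ , γ) = γ ⟨$⟩ʳ_

  module _ (Θ : Isotopism (suc n)) (auto : IsAutotopism L Θ) where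

    β-from-γ : ∀ j → σ L (αᵒ Θ o) ⟨$⟩ʳ βᵒ Θ j ≡ γᵒ Θ j
    β-from-γ j = trans (auto o j) (cong (γᵒ Θ) (row-o j))

    γ-from-α : ∀ i → entry L (αᵒ Θ i) (βᵒ Θ o) ≡ γᵒ Θ i
    γ-from-α i = trans (auto i o) (cong (γᵒ Θ) (column-o i))

    -- Row `o` is the identity, so the inverse of row `α(o)` takes `γ(x)` to `β(x)`; row `α(i)` then
    -- takes `β(x)` to `γ(σ_i(x))`.
    γ-conj : ∀ i x → σᵢσₘ⁻¹ L (αᵒ Θ o) (αᵒ Θ i) ⟨$⟩ʳ γᵒ Θ x ≡ γᵒ Θ (σ L i ⟨$⟩ʳ x)
    γ-conj i x = begin
      entry L (αᵒ Θ i) (σ L (αᵒ Θ o) ⟨$⟩ˡ γᵒ Θ x)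
        ≡⟨ cong (λ y → entry L (αᵒ Θ i) (σ L (αᵒ Θ o) ⟨$⟩ˡ y)) (β-from-γ x) ⟨
      entry L (αᵒ Θ i) (σ L (αᵒ Θ o) ⟨$⟩ˡ (σ L (αᵒ Θ o) ⟨$⟩ʳ βᵒ Θ x))
        ≡⟨ cong (entry L (αᵒ Θ i)) (inverseˡ (σ L (αᵒ Θ o))) ⟩
      entry L (αᵒ Θ i) (βᵒ Θ x)
        ≡⟨ auto i x ⟩
      γᵒ Θ (entry L i x) ∎
      where open ≡-Reasoning

    same-structure : ∀ i → cycleStructure (σᵢσₘ⁻¹ L (αᵒ Θ o) (αᵒ Θ i)) ≡ cycleStructure (σ L i)
    same-structure i =
      cycleStructure-conj (σ L i) (σᵢσₘ⁻¹ L (αᵒ Θ o) (αᵒ Θ i)) (proj₂ (proj₂ Θ)) (γ-conj i)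

    -- Listing the rows in the order `α(i)` pairs each quotient with the row `i` to which it is
    -- conjugate.
    α-o∈Δ : Δ L (αᵒ Θ o)
    α-o∈Δ = ↭-trans
      (↭-sym (tabulate-permute (proj₁ Θ) (λ i → cycleStructure (σᵢσₘ⁻¹ L (αᵒ Θ o) i))))
      (↭-reflexive (tabulate-cong same-structure))

    α∈candidates : ∀ i → αᵒ Θ i ∈ˡ candidates L (αᵒ Θ o) i
    α∈candidates i = ∈-filter⁺
      (λ k → cycleStructure (σᵢσₘ⁻¹ L (αᵒ Θ o) k) ≟ᶜ cycleStructure (σ L i)) (∈-allFin _) (same-structure i)

  infix 4 _≈³_
  _≈³_ : Rel (Isotopism (suc n)) 0ℓ
  _≈³_ = Setoid._≈_ (Sym³ (suc n))

  module _ (Θ Θ′ : Isotopism (suc n)) (auto : IsAutotopism L Θ) (auto′ : IsAutotopism L Θ′)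
           (αo≡ : αᵒ Θ o ≡ αᵒ Θ′ o) (βo≡ : βᵒ Θ o ≡ βᵒ Θ′ o) where

    γ≡-from-α≡ : ∀ {i} → αᵒ Θ i ≡ αᵒ Θ′ i → γᵒ Θ i ≡ γᵒ Θ′ i
    γ≡-from-α≡ {i} α≡ = trans (sym (γ-from-α Θ auto i))
      (trans (cong₂ (entry L) α≡ βo≡) (γ-from-α Θ′ auto′ i))

    -- Cancelling the common row `α(o)` recovers `β` from `γ`; cancelling in the common column
    -- `β(o)` recovers `α`.
    ≈-from-γ : (∀ i → γᵒ Θ i ≡ γᵒ Θ′ i) → Θ ≈³ Θ′
    ≈-from-γ γ≡ = α≡ , β≡ , γ≡
      where
      β≡ : ∀ i → βᵒ Θ i ≡ βᵒ Θ′ i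
      β≡ i = ⟨$⟩ʳ-injective (σ L (αᵒ Θ o)) (trans (β-from-γ Θ auto i) (trans (γ≡ i)
        (trans (sym (β-from-γ Θ′ auto′ i)) (cong (λ m → entry L m (βᵒ Θ′ i)) (sym αo≡)))))
      α≡ : ∀ i → αᵒ Θ i ≡ αᵒ Θ′ i
      α≡ i = proj₁ (LatinSquare.col-perm L (βᵒ Θ o)) (trans (γ-from-α Θ auto i) (trans (γ≡ i)
        (trans (sym (γ-from-α Θ′ auto′ i)) (cong (entry L (αᵒ Θ′ i)) (sym βo≡)))))

    -- The cycle of `σ_l` through `i` contains some `s` in the list; agreement of `α` at `s` gives
    -- agreement of `γ` at `s`, which spreads along the cycle to `i`.
    determined : ∀ l (ss : List (Fin (suc n))) →
                 (∀ {C} → C ∈ˡ cycles (σ L l) → ∃ λ s → s ∈ˡ l ∷ ss × s ∈ C) →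
                 (∀ i → i ∈ˡ l ∷ ss → αᵒ Θ i ≡ αᵒ Θ′ i) → Θ ≈³ Θ′
    determined l ss meets α≡ = ≈-from-γ λ i →
      let s , s∈ss , s∈orbit-i = meets (orbit∈cycles (σ L l) i)
      in conj-agree-orbit (σ L l) (σᵢσₘ⁻¹ L (αᵒ Θ o) (αᵒ Θ l)) (γᵒ Θ) (γᵒ Θ′)
           (γ-conj Θ auto l) γ′-conj i s∈orbit-i (γ≡-from-α≡ (α≡ s s∈ss)) (s∈orbit (σ L l) i)
      where
      γ′-conj : ∀ x → σᵢσₘ⁻¹ L (αᵒ Θ o) (αᵒ Θ l) ⟨$⟩ʳ γᵒ Θ′ x ≡ γᵒ Θ′ (σ L l ⟨$⟩ʳ x)
      -- Agreement of `α` at `o` and at `l` makes both copies of `γ` conjugate `σ_l` to the same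
      -- permutation; this is why `l` heads the list.
      γ′-conj x rewrite αo≡ | α≡ l (here refl) = γ-conj Θ′ auto′ l x

  autotopisms-bound : ∀ l (ss : List (Fin (suc n))) →
                      (∀ {C} → C ∈ˡ cycles (σ L l) → ∃ λ s → s ∈ˡ l ∷ ss × s ∈ C) →
                      ∣𝔄 L ∣ ≤ δ L * (length (allFin (suc n)) * product (map (λʳ L) (l ∷ ss)))
  autotopisms-bound l ss meets =
    -- Three nested counts: `α(o)` in `Δ`, then `β(o)` among all indices, then the values `α(s)`
    -- among the candidates.
    AtMost-fibres _≈³_ Fin._≟_ (λ Θ → αᵒ Θ o) (filter (Δ? L) (allFin (suc n)))
      (λ {Θ} auto → ∈-filter⁺ (Δ? L) (∈-allFin _) (α-o∈Δ Θ auto))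
      (λ m m∈ → AtMost-fibres _≈³_ Fin._≟_ (λ Θ → βᵒ Θ o) (allFin (suc n)) (λ _ → ∈-allFin _)
        λ b _ → subst (λ k → AtMost _≈³_ k
            (λ Θ → (IsAutotopism L Θ × αᵒ Θ o ≡ m) × βᵒ Θ o ≡ b))
          (cong product (map-cong (length-candidates L (proj₂ (∈-filter⁻ (Δ? L) {xs = allFin (suc n)} m∈)))
            (l ∷ ss)))
          (AtMost-product _≈³_ Fin._≟_ (λ i Θ → αᵒ Θ i) (candidates L m) (l ∷ ss)
            -- Matching on `refl` identifies `m` with `α(o)`, the index relative to which the
            -- candidates are defined.
            (λ { i {Θ} ((auto , refl) , _) → α∈candidates Θ auto i })
            (λ { Θ Θ′ ((auto , αo) , βo) ((auto′ , αo′) , βo′) →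
                 determined Θ Θ′ auto auto′ (trans αo (sym αo′)) (trans βo (sym βo′)) l ss meets })))
      -- The bound is applied to `𝔄 L` itself, whose members are pairwise inequivalent because
      -- `isotopisms` has no repetitions.
      (𝔄 L)
      (AllPairsₚ.filter⁺ (isAutotopism? L) (isotopisms-unique (suc n)))
      (all-filter (isAutotopism? L) (isotopisms (suc n)))

theorem1 : ∀ (n : ℕ) (L : LatinSquare n) → Reduced L →
    ∀ (l : Fin n) → ν (σ L l) ≡ νᴸ L →
    ∀ (C₁ : Subset n) (Cs : List (Subset n)) → C₁ ∷ Cs ↭ cycles (σ L l) → l ∈ C₁ →
    ∣𝔄 L ∣ ≤ n * δ L * λʳ L l * product (map (λᶜ L) Cs)
theorem1 n@(suc _) L reduced l _ C₁ Cs decomp l∈C₁ = begin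
  ∣𝔄 L ∣
    ≤⟨ ReducedSquare.autotopisms-bound L reduced l ss meets ⟩
  δ L * (length (allFin n) * (λʳ L l * product (map (λʳ L) ss)))
    ≡⟨ cong (λ k → δ L * (k * (λʳ L l * product (map (λʳ L) ss)))) (length-tabulate {n = n} id) ⟩
  δ L * (n * (λʳ L l * product (map (λʳ L) ss)))
    ≡⟨ rearrange (δ L) n (λʳ L l) (product (map (λʳ L) ss)) ⟩
  n * δ L * λʳ L l * product (map (λʳ L) ss)
    ≤⟨ *-monoʳ-≤ (n * δ L * λʳ L l) ss≤ ⟩
  n * δ L * λʳ L l * product (map (λᶜ L) Cs) ∎
  where
  open ≤-Reasoning
  rearrange : ∀ a b c d → a * (b * (c * d)) ≡ b * a * c * d
  rearrange = solve-∀
  nonempty : All (λ C → ∃ (_∈ C)) Cs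
  nonempty = All.tabulate λ C∈Cs →
    let s , C≡ = ∈-cycles⁻ (σ L l) (∈-resp-↭ decomp (there C∈Cs))
    in s , subst (s ∈_) (sym C≡) (s∈orbit (σ L l) s)
  chosen = transversal L Cs nonempty
  ss = proj₁ chosen
  ss≤ = proj₂ (proj₂ chosen)
  meets : ∀ {C} → C ∈ˡ cycles (σ L l) → ∃ λ s → s ∈ˡ l ∷ ss × s ∈ C
  meets C∈ with ∈-resp-↭ (↭-sym decomp) C∈
  -- `C₁` is represented by `l` itself, so its factor is `λʳ L l` instead of a minimum over the
  -- cycle.
  ... | here refl  = l , here refl , l∈C₁
  ... | there C∈Cs = let s , s∈ss , s∈C = proj₁ (proj₂ chosen) C∈Cs in s , there s∈ss , s∈C
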